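{- Let $G$ be a finite simple graph of tree-width $3$. Then $\mathrm{ch}'(G) \le \Delta(G)+1$, where $\Delta(G)$ is the maximum degree of $G$.
   Context: Given a list assignment $L$ assigning to each edge $e$ of $G$ a set $L(e)\subset\mathbb{N}$, an $L$-edge-colouring is a map $\mathcal{C}$ on $E(G)$ with $\mathcal{C}(e)\in L(e)$ for all $e$ and with adjacent edges (edges sharing an endpoint) receiving different colours. $G$ is $k$-edge-choosable if an $L$-edge-colouring exists for every list assignment $L$ with $|L(e)|\ge k$ for all edges $e$. The list chromatic index $\mathrm{ch}'(G)$ is the smallest $k$ such that $G$ is $k$-edge-choosable. Tree-width is defined via tree decompositions in the usual way: a tree decomposition of width $k$ has all bags of size at most $k+1$. -}

module Defs where

open import Data.Fin using (Fin; _<_)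
open import Data.Fin.Subset using (Subset; _∈_; ∣_∣)
open import Data.List using (List; _∷_; []; length)
import Data.List as List
open import Data.List.Extrema.Nat using (max)
open import Data.List.Relation.Unary.Unique.Propositional using (Unique)
open import Data.Nat using (ℕ; suc; _≤_; NonZero)
open import Data.Product using (∃-syntax; _×_)
open import Data.Sum using (_⊎_)
import Data.Vec as Vec
open import Function.Definitions using (Injective)
open import Level using (0ℓ)
open import Relation.Binary using (Rel; Irreflexive; Symmetric; Decidable)
open import Relation.Binary.Construct.Closure.ReflexiveTransitive using (Star; ε; _◅_)
open import Relation.Binary.PropositionalEquality using (_≡_; _≢_)
open import Relation.Nullary using (¬_; does)
open import Relation.Unary using (Pred; U)

IsLeast : ∀ {ℓ} → Pred ℕ ℓ → Pred ℕ ℓ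
IsLeast P k = P k × (∀ j → P j → k ≤ j)

record Graph (n : ℕ) : Set₁ where
  infix 4 _~_ _~?_
  field
    _~_      : Rel (Fin n) 0ℓ
    _~?_     : Decidable _~_
    ~-sym    : Symmetric _~_
    ~-irrefl : Irreflexive _≡_ _~_

module _ {n : ℕ} (G : Graph n) where
  open Graph G

  neighbours : Fin n → Subset n
  neighbours v = Vec.tabulate (λ w → does (v ~? w))

  degree : Fin n → ℕ
  degree v = ∣ neighbours v ∣

  Δ : ℕ
  Δ = max 0 (List.tabulate degree)

  -- Each edge is represented once, by its endpoints in increasing order; the
  -- proof fields are irrelevant, so an edge is determined by its endpoints.
  record Edge : Set where
    constructor edge
    field
      lo hi  : Fin n
      .lo<hi : lo < hi
      .lo~hi : lo ~ hi

  _isEndOf_ : Fin n → Edge → Set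
  v isEndOf e = v ≡ Edge.lo e ⊎ v ≡ Edge.hi e

  AdjacentEdges : Rel Edge 0ℓ
  AdjacentEdges e f = e ≢ f × ∃[ v ] (v isEndOf e × v isEndOf f)

  ListAssignment : Set₁
  ListAssignment = Edge → Pred ℕ 0ℓ

  record ListEdgeColouring (L : ListAssignment) : Set where
    field
      colour   : Edge → ℕ
      fromList : ∀ e → L e (colour e)
      proper   : ∀ e f → AdjacentEdges e f → colour e ≢ colour f

  -- ∣ S ∣ ≥ k for a possibly infinite set S of colours.
  HasAtLeast : ℕ → Pred ℕ 0ℓ → Set
  HasAtLeast k S = ∃[ f ] (Injective {A = Fin k} _≡_ _≡_ f × (∀ i → S (f i)))

  EdgeChoosable : ℕ → Set₁
  EdgeChoosable k =
    (L : ListAssignment) → (∀ e → HasAtLeast k (L e)) → ListEdgeColouring L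

  IsListChromaticIndex : ℕ → Set₁
  IsListChromaticIndex = IsLeast EdgeChoosable

  -- The subgraph induced by S is connected (or empty).
  ConnectedOn : Pred (Fin n) 0ℓ → Set
  ConnectedOn S =
    ∀ s t → S s → S t → Star (λ a b → a ~ b × S a × S b) s t

  vertices : ∀ {u v} → Star _~_ u v → List (Fin n)
  vertices {u} ε       = u ∷ []
  vertices {u} (_ ◅ p) = u ∷ vertices p

  -- A cycle is a path on at least three vertices with adjacent ends.
  record Cycle : Set where
    field
      {start end} : Fin n
      path        : Star _~_ start end
      distinct    : Unique (vertices path)
      long        : 3 ≤ length (vertices path)
      closing     : end ~ start

  record IsTree : Set where
    field
      nonEmpty  : NonZero n
      connected : ConnectedOn U
      acyclic   : ¬ Cycle

record TreeDecomposition {n : ℕ} (G : Graph n) : Set₁ where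
  open Graph G
  field
    {size}       : ℕ
    tree         : Graph size
    isTree       : IsTree tree
    bag          : Fin size → Subset n
    coversVertex : ∀ v → ∃[ t ] v ∈ bag t
    coversEdge   : ∀ {u v} → u ~ v → ∃[ t ] (u ∈ bag t × v ∈ bag t)
    coherent     : ∀ v → ConnectedOn tree (λ t → v ∈ bag t)

HasWidthAtMost : ∀ {n} {G : Graph n} → TreeDecomposition G → ℕ → Set
HasWidthAtMost D k = ∀ t → ∣ bag t ∣ ≤ suc k
  where open TreeDecomposition D

IsTreeWidth : ∀ {n} → Graph n → ℕ → Set₁
IsTreeWidth G = IsLeast (λ k → ∃[ D ] HasWidthAtMost {G = G} D k)

{-# OPTIONS --safe #-}

-- Write D for Δ(G) and delete edges one configuration at a time, the lists
-- keeping size D + 1.  An edge vw with d(v) + d(w) ≤ D + 2 can be coloured last.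
-- Otherwise eliminate the vertices along the rooted tree decomposition, deepest
-- first, and let v be the first vertex with a neighbour eliminated before it.
-- Such an earlier neighbour w has all its other neighbours in the set Q of the at
-- most three vertices other than v in the highest bag containing v; hence d(w) = 3
-- and d(v) = D.  Two earlier neighbours of v share a neighbour in Q and give a
-- 4-cycle whose edges keep two colours each when everything else is coloured.  If
-- w is the only one, then D ≤ 4; the edges at v and w contain a triangle with a
-- pendant edge (D = 3) or K₄ minus an edge (D = 4), which can again be coloured
-- from the colours that remain.
-- The least k in the statement is found by search, since k-edge-choosability
-- depends only on finitely many coincidence patterns between lists of size k.
module Submission where

open import Data.Fin using (Fin; toℕ; combine; remQuot; finToFun; funToFin)
import Data.Fin as Fin
import Data.Fin.Properties as Fin
open import Data.Fin.Subset using (Subset; ∣_∣) renaming (_∈_ to _∈ₛ_)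
import Data.Fin.Subset.Properties as Subset
open import Data.List
  using (List; []; _∷_; length; filter; _++_; map; allFin; cartesianProduct; tabulate; lookup; concatMap)
open import Data.List.Extrema.Nat
  using (argmax; argmin; argmax-all; argmin-all; f[xs]≤f[argmax]; f[argmin]≤f[xs]; xs≤max)
open import Data.List.Membership.Propositional using (_∈_; _∉_; lose; find)
import Data.List.Membership.DecPropositional as DecMembership
open import Data.List.Membership.Propositional.Properties
  using (∈-filter⁺; ∈-filter⁻; ∈-++⁻; ∈-++⁺ˡ; ∈-++⁺ʳ; ∈-map⁺; ∈-allFin; ∈-cartesianProduct⁺;
         ∈-concatMap⁺; ∈-tabulate⁺; ∈-tabulate⁻)
open import Data.List.Properties using (filter-notAll; length-++; length-map; length-tabulate)
open import Data.List.Relation.Binary.Subset.Propositional using (_⊆_)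
open import Data.List.Relation.Unary.All as All using (All; []; _∷_)
import Data.List.Relation.Unary.All.Properties as All
open import Data.List.Relation.Unary.AllPairs using (AllPairs; []; _∷_)
open import Data.List.Relation.Unary.Any as Any using (Any; here; there)
open import Data.List.Relation.Unary.Any.Properties using (lookup-index)
open import Data.List.Relation.Unary.Unique.Propositional using (Unique)
import Data.List.Relation.Unary.Unique.Propositional.Properties as Unique
open import Data.Nat using (ℕ; zero; suc; _+_; _*_; _≤_; _<_; z≤n; s≤s)
import Data.Nat as ℕ
open import Data.Nat.Induction using (<-wellFounded)
open import Data.Nat.Properties
open import Data.Nat.Tactic.RingSolver using (solve-∀)
open import Data.Product using (∃-syntax; _×_; _,_; proj₁; proj₂; ∃)
open import Data.Product.Properties using () renaming (≡-dec to ×-≡-dec)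
open import Data.Sum using (_⊎_; inj₁; inj₂)
open import Data.Vec.Properties using (lookup⇒[]=; lookup∘tabulate)
open import Defs
open import Function using (_∘_; case_of_)
open import Induction.WellFounded using (Acc; acc)
open import Relation.Binary using (DecidableEquality; tri<; tri≈; tri>)
open import Relation.Binary.Construct.Closure.ReflexiveTransitive as Star using (Star; ε; _◅_; _◅◅_)
open import Relation.Binary.PropositionalEquality
open import Relation.Nullary
  using (¬_; Dec; does; yes; no; ¬?; contradiction; decidable-stable; _×-dec_; _⊎-dec_; _→-dec_; map′; recompute)
open import Relation.Nullary.Decidable using (dec-true)
import Relation.Unary as U


-- Counting in duplicate-free lists.

module _ {A : Set} (_≟_ : DecidableEquality A) where
  open DecMembership _≟_ using (_∈?_; _∉?_)

  -- Filtering the head of `xs` out of `ys` shortens `ys` strictly and keeps the tail of `xs`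
  -- inside.
  Unique-⊆⇒length-≤ : ∀ {xs ys : List A} → Unique xs → xs ⊆ ys → length xs ≤ length ys
  Unique-⊆⇒length-≤ [] _ = z≤n
  Unique-⊆⇒length-≤ {x ∷ xs} {ys} (x≢ ∷ uxs) sub =
    ≤-trans (s≤s (Unique-⊆⇒length-≤ uxs λ z∈ →
               ∈-filter⁺ (λ y → ¬? (x ≟ y)) (sub (there z∈)) (All.lookup x≢ z∈)))
            (filter-notAll (λ y → ¬? (x ≟ y)) ys (Any.map (λ x≡y x≢y → x≢y x≡y) (sub (here refl))))

  pick : ∀ {xs : List A} ys → Unique xs → length ys < length xs → ∃[ x ] (x ∈ xs × x ∉ ys)
  pick {xs} ys uxs lt with Any.any? (_∉? ys) xs
  ... | yes p = find p
  ... | no ¬p = contradiction (Unique-⊆⇒length-≤ uxs sub) (<⇒≱ lt)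
    where
    sub : xs ⊆ ys
    sub {x} x∈ with x ∈? ys
    ... | yes x∈ys = x∈ys
    ... | no x∉ys = contradiction (lose x∈ x∉ys) ¬p

  -- If the lists were disjoint, `xs ++ ys` would be duplicate-free inside `zs`, hence no longer
  -- than `zs`.
  common : ∀ {xs ys zs : List A} → Unique xs → Unique ys → xs ⊆ zs → ys ⊆ zs →
    length zs < length xs + length ys → ∃[ x ] (x ∈ xs × x ∈ ys)
  common {xs} {ys} {zs} uxs uys xs⊆ ys⊆ lt with Any.any? (_∈? ys) xs
  ... | yes p = find p
  ... | no ¬p = contradiction
    (subst (_≤ length zs) (length-++ xs)
      (Unique-⊆⇒length-≤ (Unique.++⁺ uxs uys λ (p , q) → ¬p (lose p q))
        (λ x∈ → case ∈-++⁻ xs x∈ of λ { (inj₁ p) → xs⊆ p ; (inj₂ q) → ys⊆ q })))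
    (<⇒≱ lt)

  length-remove : ∀ (xs ys : List A) → Unique xs →
    length xs ≤ length (filter (_∉? ys) xs) + length ys
  length-remove xs ys uxs = subst (length xs ≤_) (length-++ (filter (_∉? ys) xs))
    (Unique-⊆⇒length-≤ uxs sub)
    where
    sub : xs ⊆ filter (_∉? ys) xs ++ ys
    sub {x} x∈ with x ∈? ys
    ... | yes x∈ys = ∈-++⁺ʳ (filter (_∉? ys) xs) x∈ys
    ... | no x∉ys = ∈-++⁺ˡ (∈-filter⁺ (_∉? ys) x∈ x∉ys)

-- List colouring of the 4-cycle and of two small line graphs.

open DecMembership ℕ._≟_ using () renaming (_∈?_ to _∈ℕ?_; _∉?_ to _∉ℕ?_)

∈∉⇒≢ : ∀ {A : Set} {x y : A} {xs} → x ∈ xs → y ∉ xs → x ≢ y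
∈∉⇒≢ x∈ y∉ refl = y∉ x∈

-- Two non-adjacent edges A and C with a common neighbour B can be coloured so
-- that B loses at most one colour, unless the list of B is large.
savesColour : ∀ {A B C : List ℕ} → Unique A → Unique C →
  (∃[ x ] (x ∈ A × x ∈ C)) ⊎ (∃[ a ] (a ∈ A × a ∉ B)) ⊎ (∃[ c ] (c ∈ C × c ∉ B)) ⊎
  length A + length C ≤ length B
savesColour {A} {B} {C} uA uC
  with Any.any? (_∈ℕ? C) A | Any.any? (_∉ℕ? B) A | Any.any? (_∉ℕ? B) C
... | yes p | _     | _     = inj₁ (find p)
... | no _  | yes p | _     = inj₂ (inj₁ (find p))
... | no _  | no _  | yes p = inj₂ (inj₂ (inj₁ (find p)))
... | no disjoint | no A⊆B | no C⊆B =
  inj₂ (inj₂ (inj₂ (≮⇒≥ λ lt →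
    let x , x∈A , x∈C = common ℕ._≟_ uA uC (⊆B A⊆B) (⊆B C⊆B) lt
    in disjoint (lose x∈A x∈C))))
  where
  ⊆B : ∀ {X} → ¬ Any (_∉ B) X → X ⊆ B
  ⊆B none {x} x∈ = decidable-stable (x ∈ℕ? B) λ x∉ → none (lose x∈ x∉)

module _ {A B C D : List ℕ} (uA : Unique A) (uB : Unique B) (uC : Unique C) (uD : Unique D) where

  -- The 4-cycle is 2-choosable. A colour shared by `A` and `C` costs `B` and `D` only one colour; a
  -- colour of `A` or `C` absent from `B` lets the colouring run round the cycle and end at `B`;
  -- otherwise `B` has at least four colours and is served last.
  square-choosable : 2 ≤ length A → 2 ≤ length B → 2 ≤ length C → 2 ≤ length D →
    ∃[ a ] ∃[ b ] ∃[ c ] ∃[ d ] (a ∈ A × b ∈ B × c ∈ C × d ∈ D ×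
      a ≢ b × b ≢ c × c ≢ d × d ≢ a)
  square-choosable lA lB lC lD with savesColour {B = B} uA uC
  ... | inj₁ (a , a∈A , a∈C) =
    let b , b∈B , b∉ = pick ℕ._≟_ (a ∷ []) uB lB
        d , d∈D , d∉ = pick ℕ._≟_ (a ∷ []) uD lD
    in a , b , a , d , a∈A , b∈B , a∈C , d∈D ,
       b∉ ∘ here ∘ sym , b∉ ∘ here , d∉ ∘ here ∘ sym , d∉ ∘ here
  ... | inj₂ (inj₁ (a , a∈A , a∉B)) =
    let d , d∈D , d∉ = pick ℕ._≟_ (a ∷ []) uD lD
        c , c∈C , c∉ = pick ℕ._≟_ (d ∷ []) uC lC
        b , b∈B , b∉ = pick ℕ._≟_ (c ∷ []) uB lB
    in a , b , c , d , a∈A , b∈B , c∈C , d∈D ,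
       ∈∉⇒≢ b∈B a∉B ∘ sym , b∉ ∘ here , c∉ ∘ here , d∉ ∘ here
  ... | inj₂ (inj₂ (inj₁ (c , c∈C , c∉B))) =
    let d , d∈D , d∉ = pick ℕ._≟_ (c ∷ []) uD lD
        a , a∈A , a∉ = pick ℕ._≟_ (d ∷ []) uA lA
        b , b∈B , b∉ = pick ℕ._≟_ (a ∷ []) uB lB
    in a , b , c , d , a∈A , b∈B , c∈C , d∈D ,
       b∉ ∘ here ∘ sym , ∈∉⇒≢ b∈B c∉B , d∉ ∘ here ∘ sym , a∉ ∘ here ∘ sym
  ... | inj₂ (inj₂ (inj₂ A+C≤B)) =
    let d , d∈D , d∉ = pick ℕ._≟_ [] uD (<⇒≤ lD)
        a , a∈A , a∉ = pick ℕ._≟_ (d ∷ []) uA lA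
        c , c∈C , c∉ = pick ℕ._≟_ (d ∷ []) uC lC
        b , b∈B , b∉ = pick ℕ._≟_ (a ∷ c ∷ []) uB (<⇒≤ (≤-trans (+-mono-≤ lA lC) A+C≤B))
    in a , b , c , d , a∈A , b∈B , c∈C , d∈D ,
       b∉ ∘ here ∘ sym , b∉ ∘ there ∘ here , c∉ ∘ here , a∉ ∘ here ∘ sym

  -- The line graph of a triangle with a pendant edge A: the triangle has the
  -- edges B and D, which meet A, and C, which does not.
  paw-choosable : 2 ≤ length A → 3 ≤ length B → 2 ≤ length C → 3 ≤ length D →
    ∃[ a ] ∃[ b ] ∃[ c ] ∃[ d ] (a ∈ A × b ∈ B × c ∈ C × d ∈ D ×
      a ≢ b × a ≢ d × b ≢ c × b ≢ d × c ≢ d)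
  paw-choosable lA lB lC lD with savesColour {B = B} uA uC
  ... | inj₁ (a , a∈A , a∈C) =
    let d , d∈D , d∉ = pick ℕ._≟_ (a ∷ []) uD (<⇒≤ lD)
        b , b∈B , b∉ = pick ℕ._≟_ (a ∷ d ∷ []) uB lB
    in a , b , a , d , a∈A , b∈B , a∈C , d∈D ,
       b∉ ∘ here ∘ sym , d∉ ∘ here ∘ sym , b∉ ∘ here , b∉ ∘ there ∘ here , d∉ ∘ here ∘ sym
  ... | inj₂ (inj₁ (a , a∈A , a∉B)) =
    let c , c∈C , c∉ = pick ℕ._≟_ [] uC (<⇒≤ lC)
        d , d∈D , d∉ = pick ℕ._≟_ (a ∷ c ∷ []) uD lD
        b , b∈B , b∉ = pick ℕ._≟_ (c ∷ d ∷ []) uB lB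
    in a , b , c , d , a∈A , b∈B , c∈C , d∈D ,
       ∈∉⇒≢ b∈B a∉B ∘ sym , d∉ ∘ here ∘ sym , b∉ ∘ here , b∉ ∘ there ∘ here , d∉ ∘ there ∘ here ∘ sym
  ... | inj₂ (inj₂ (inj₁ (c , c∈C , c∉B))) =
    let a , a∈A , a∉ = pick ℕ._≟_ [] uA (<⇒≤ lA)
        d , d∈D , d∉ = pick ℕ._≟_ (a ∷ c ∷ []) uD lD
        b , b∈B , b∉ = pick ℕ._≟_ (a ∷ d ∷ []) uB lB
    in a , b , c , d , a∈A , b∈B , c∈C , d∈D ,
       b∉ ∘ here ∘ sym , d∉ ∘ here ∘ sym , ∈∉⇒≢ b∈B c∉B , b∉ ∘ there ∘ here , d∉ ∘ there ∘ here ∘ sym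
  -- `B` has at least four colours here, so it can be coloured after its three neighbours.
  ... | inj₂ (inj₂ (inj₂ A+C≤B)) =
    let a , a∈A , a∉ = pick ℕ._≟_ [] uA (<⇒≤ lA)
        c , c∈C , c∉ = pick ℕ._≟_ [] uC (<⇒≤ lC)
        d , d∈D , d∉ = pick ℕ._≟_ (a ∷ c ∷ []) uD lD
        b , b∈B , b∉ = pick ℕ._≟_ (a ∷ c ∷ d ∷ []) uB (≤-trans (+-mono-≤ lA lC) A+C≤B)
    in a , b , c , d , a∈A , b∈B , c∈C , d∈D ,
       b∉ ∘ here ∘ sym , d∉ ∘ here ∘ sym , b∉ ∘ there ∘ here , b∉ ∘ there ∘ there ∘ here ,
       d∉ ∘ there ∘ here ∘ sym

-- The line graph of K₄ minus an edge: H is the edge joining the vertices of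
-- degree three, and A, B, C, D is the 4-cycle formed by the remaining edges.
diamond-choosable : ∀ {H A B C D : List ℕ} →
  Unique H → Unique A → Unique B → Unique C → Unique D →
  4 ≤ length H → 2 ≤ length A → 2 ≤ length B → 3 ≤ length C → 3 ≤ length D →
  ∃[ h ] ∃[ a ] ∃[ b ] ∃[ c ] ∃[ d ] (h ∈ H × a ∈ A × b ∈ B × c ∈ C × d ∈ D ×
    h ≢ a × h ≢ b × h ≢ c × h ≢ d × a ≢ b × b ≢ c × c ≢ d × d ≢ a)
diamond-choosable {H} {a₁ ∷ a₂ ∷ _} {b₁ ∷ b₂ ∷ _} {C} {D}
  uH ((a₁≢a₂ ∷ _) ∷ _) ((b₁≢b₂ ∷ _) ∷ _) uC uD lH (s≤s (s≤s _)) (s≤s (s≤s _)) lC lD =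
  let h , a , b , c , d , h∈ , a∈ , b∈ , rest = go
  in h , a , b , c , d , h∈ , extend a∈ , extend b∈ , rest
  where
  -- With exactly two colours kept, these lists can be examined by cases, and `B₂` with one more
  -- colour cannot cover `H`.
  A₂ = a₁ ∷ a₂ ∷ []
  B₂ = b₁ ∷ b₂ ∷ []

  uA₂ : Unique A₂
  uA₂ = (a₁≢a₂ ∷ []) ∷ [] ∷ []

  uB₂ : Unique B₂
  uB₂ = (b₁≢b₂ ∷ []) ∷ [] ∷ []

  extend : ∀ {x y z : ℕ} {xs} → x ∈ y ∷ z ∷ [] → x ∈ y ∷ z ∷ xs
  extend (here p) = here p
  extend (there (here p)) = there (here p)

  Goal = ∃[ h ] ∃[ a ] ∃[ b ] ∃[ c ] ∃[ d ] (h ∈ H × a ∈ A₂ × b ∈ B₂ × c ∈ C × d ∈ D ×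
    h ≢ a × h ≢ b × h ≢ c × h ≢ d × a ≢ b × b ≢ c × c ≢ d × d ≢ a)

  -- Such an `h` costs only `C` and `D` one colour each, so the 4-cycle keeps two colours
  -- everywhere.
  avoiding : ∀ {h} → h ∈ H → h ∉ A₂ → h ∉ B₂ → Goal
  avoiding {h} h∈ h∉A h∉B =
    let a , b , c , d , a∈ , b∈ , c∈ , d∈ , proper =
          square-choosable uA₂ uB₂ (Unique.filter⁺ ≢h? uC) (Unique.filter⁺ ≢h? uD)
            ≤-refl ≤-refl (minus-one uC lC) (minus-one uD lD)
        c∈C , c≢h = ∈-filter⁻ ≢h? {xs = C} c∈
        d∈D , d≢h = ∈-filter⁻ ≢h? {xs = D} d∈
    in h , a , b , c , d , h∈ , a∈ , b∈ , c∈C , d∈D ,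
       ∈∉⇒≢ a∈ h∉A ∘ sym , ∈∉⇒≢ b∈ h∉B ∘ sym , c≢h ∘ here ∘ sym , d≢h ∘ here ∘ sym ,
       proper
    where
    ≢h? = _∉ℕ? h ∷ []
    minus-one : ∀ {X} → Unique X → 3 ≤ length X → 2 ≤ length (filter ≢h? X)
    minus-one {X} uX lX = +-cancelʳ-≤ 1 2 _ (≤-trans lX (length-remove ℕ._≟_ X (h ∷ []) uX))

  -- Here `A₂` lies within `h` and `a`. If `a` is absent from `B₂`, then `b` has only `c` to avoid.
  -- If `a` lies in `B₂`, then `h ∷ B₂` covers both lists, and a colour of `H` outside these three
  -- avoids both.
  meeting : ∀ {h a} → h ∈ H → h ∉ B₂ → a ∈ A₂ → h ≢ a →
    (∀ {x} → x ∈ A₂ → x ≢ h → x ≡ a) → Goal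
  meeting {h} {a} h∈ h∉B a∈ h≢a onlyA with a ∈ℕ? B₂
  ... | no a∉B =
    let d , d∈ , d∉ = pick ℕ._≟_ (h ∷ a ∷ []) uD lD
        c , c∈ , c∉ = pick ℕ._≟_ (h ∷ d ∷ []) uC lC
        b , b∈ , b∉ = pick ℕ._≟_ (c ∷ []) uB₂ ≤-refl
    in h , a , b , c , d , h∈ , a∈ , b∈ , c∈ , d∈ ,
       h≢a , ∈∉⇒≢ b∈ h∉B ∘ sym , c∉ ∘ here ∘ sym , d∉ ∘ here ∘ sym ,
       ∈∉⇒≢ b∈ a∉B ∘ sym , b∉ ∘ here , c∉ ∘ there ∘ here , d∉ ∘ there ∘ here
  ... | yes a∈B =
    let h′ , h′∈ , h′∉ = pick ℕ._≟_ (h ∷ B₂) uH lH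
    in avoiding h′∈
         (λ h′∈A → h′∉ (there (subst (_∈ _) (sym (onlyA h′∈A (h′∉ ∘ here))) a∈B)))
         (h′∉ ∘ there)

  go : Goal
  go with pick ℕ._≟_ B₂ uH (<⇒≤ lH)
  ... | h , h∈ , h∉B with h ℕ.≟ a₁ | h ℕ.≟ a₂
  ...   | yes refl | _ = meeting h∈ h∉B (there (here refl)) a₁≢a₂
    λ { (here x≡) x≢ → contradiction x≡ x≢ ; (there (here x≡)) _ → x≡ }
  ...   | no _ | yes refl = meeting h∈ h∉B (here refl) (a₁≢a₂ ∘ sym)
    λ { (here x≡) _ → x≡ ; (there (here x≡)) x≢ → contradiction x≡ x≢ }
  ...   | no h≢a₁ | no h≢a₂ =
    avoiding h∈ (λ { (here p) → h≢a₁ p ; (there (here p)) → h≢a₂ p }) h∉B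

-- Deleting edges and extending colourings

module _ {n : ℕ} where

  Joins : Fin n × Fin n → Fin n → Fin n → Set
  Joins (a , b) u v = (u ≡ a × v ≡ b) ⊎ (u ≡ b × v ≡ a)

  joins? : ∀ e u v → Dec (Joins e u v)
  joins? (a , b) u v = (u Fin.≟ a ×-dec v Fin.≟ b) ⊎-dec (u Fin.≟ b ×-dec v Fin.≟ a)

  Joins-sym : ∀ e {u v} → Joins e u v → Joins e v u
  Joins-sym _ (inj₁ (p , q)) = inj₂ (q , p)
  Joins-sym _ (inj₂ (p , q)) = inj₁ (q , p)

  Joins-unique : ∀ e {u v w} → Joins e u v → Joins e u w → v ≡ w
  Joins-unique _ (inj₁ (refl , refl)) (inj₁ (_ , refl)) = refl
  Joins-unique _ (inj₁ (refl , refl)) (inj₂ (refl , refl)) = refl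
  Joins-unique _ (inj₂ (refl , refl)) (inj₁ (refl , refl)) = refl
  Joins-unique _ (inj₂ (refl , refl)) (inj₂ (_ , refl)) = refl

  Meets : Fin n × Fin n → Fin n × Fin n → Set
  Meets (a , b) (c , d) = (a ≡ c ⊎ a ≡ d) ⊎ (b ≡ c ⊎ b ≡ d)

  infixl 5 _∖_ _∖∖_

  _∖_ : Graph n → Fin n × Fin n → Graph n
  H ∖ e = record
    { _~_      = λ u v → u ~ v × ¬ Joins e u v
    ; _~?_     = λ u v → (u ~? v) ×-dec ¬? (joins? e u v)
    ; ~-sym    = λ (p , q) → ~-sym p , q ∘ Joins-sym e
    ; ~-irrefl = λ eq (p , _) → ~-irrefl eq p
    } where open Graph H

  -- The head is deleted last, so it is the first edge that `extend` puts back.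
  _∖∖_ : Graph n → List (Fin n × Fin n) → Graph n
  H ∖∖ []       = H
  H ∖∖ (e ∷ es) = (H ∖∖ es) ∖ e

  module _ (H : Graph n) where
    open Graph H

    nbrs : Fin n → List (Fin n)
    nbrs u = filter (u ~?_) (allFin n)

    deg : Fin n → ℕ
    deg u = length (nbrs u)

    -- Each edge counts in both directions; the length is the measure of the induction in
    -- `colourable`.
    arcs : List (Fin n × Fin n)
    arcs = filter (λ (u , v) → u ~? v) (cartesianProduct (allFin n) (allFin n))

    nbrs-unique : ∀ u → Unique (nbrs u)
    nbrs-unique u = Unique.filter⁺ (u ~?_) (Unique.allFin⁺ n)

    ∈-nbrs⁺ : ∀ {u v} → u ~ v → v ∈ nbrs u
    ∈-nbrs⁺ {u} {v} p = ∈-filter⁺ (u ~?_) (∈-allFin v) p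

    ∈-nbrs⁻ : ∀ {u v} → v ∈ nbrs u → u ~ v
    ∈-nbrs⁻ {u} p = proj₂ (∈-filter⁻ (u ~?_) {xs = allFin n} p)

    ∖∖⇒~ : ∀ es {u v} → Graph._~_ (H ∖∖ es) u v → u ~ v
    ∖∖⇒~ []       p = p
    ∖∖⇒~ (e ∷ es) (p , _) = ∖∖⇒~ es p

    ∖∖⇒¬Joins : ∀ es {u v} → Graph._~_ (H ∖∖ es) u v → ¬ Any (λ e → Joins e u v) es
    ∖∖⇒¬Joins (e ∷ es) (_ , ¬j) (here j)  = ¬j j
    ∖∖⇒¬Joins (e ∷ es) (p , _)  (there j) = ∖∖⇒¬Joins es p j

  -- The neighbours `xs` cut off from `u` and those that remain are disjoint parts of the old
  -- neighbourhood.
  deg-∖∖ : ∀ H es {u} {xs} → Unique xs →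
    All (λ x → Graph._~_ H u x × Any (λ e → Joins e u x) es) xs →
    length xs + deg (H ∖∖ es) u ≤ deg H u
  deg-∖∖ H es {u} {xs} uxs removed = subst (_≤ deg H u) (length-++ xs)
    (Unique-⊆⇒length-≤ Fin._≟_
      (Unique.++⁺ uxs (nbrs-unique (H ∖∖ es) u)
        λ (x∈ , x∈′) → ∖∖⇒¬Joins H es (∈-nbrs⁻ (H ∖∖ es) x∈′) (proj₂ (All.lookup removed x∈)))
      λ x∈ → case ∈-++⁻ xs x∈ of λ
        { (inj₁ p) → ∈-nbrs⁺ H (proj₁ (All.lookup removed p))
        ; (inj₂ p) → ∈-nbrs⁺ H (∖∖⇒~ H es (∈-nbrs⁻ (H ∖∖ es) p)) })

  arcs-∖∖ : ∀ H {a b} es → Graph._~_ H a b →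
    length (arcs (H ∖∖ ((a , b) ∷ es))) < length (arcs H)
  arcs-∖∖ H {a} {b} es a~b = Unique-⊆⇒length-≤ (×-≡-dec Fin._≟_ Fin._≟_)
    (All.tabulate (λ p∈ eq → absent (subst (_∈ arcs H′) (sym eq) p∈)) AllPairs.∷
      Unique.filter⁺ _ (Unique.cartesianProduct⁺ (Unique.allFin⁺ n) (Unique.allFin⁺ n)))
    λ { (here refl) → present a~b ; (there p) → present (∖∖⇒~ H ((a , b) ∷ es) (adjacent p)) }
    where
    pairs = cartesianProduct (allFin n) (allFin n)
    H′ = H ∖∖ ((a , b) ∷ es)
    adjacent : ∀ {u v} → (u , v) ∈ arcs H′ → Graph._~_ H′ u v
    adjacent = proj₂ ∘ ∈-filter⁻ (λ (u , v) → Graph._~?_ H′ u v) {xs = pairs}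
    absent : (a , b) ∉ arcs H′
    absent p = proj₂ (adjacent p) (inj₁ (refl , refl))
    present : ∀ {u v} → Graph._~_ H u v → (u , v) ∈ arcs H
    present {u} {v} = ∈-filter⁺ (λ (u , v) → Graph._~?_ H u v)
      (∈-cartesianProduct⁺ (∈-allFin u) (∈-allFin v))

  -- Lists sit on all pairs of vertices rather than on the edges of one graph, so the same lists
  -- serve every graph obtained by deletion.
  record Lists : Set where
    field
      lists  : Fin n → Fin n → List ℕ
      symm   : ∀ u v → lists u v ≡ lists v u
      unique : ∀ u v → Unique (lists u v)

  module _ (L : Lists) where
    open Lists L

    record Colouring (H : Graph n) : Set where
      open Graph H
      field
        colour     : Fin n → Fin n → ℕ
        colour-sym : ∀ u v → colour u v ≡ colour v u
        listed     : ∀ {u v} → u ~ v → colour u v ∈ lists u v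
        proper     : ∀ {u v w} → u ~ v → u ~ w → v ≢ w → colour u v ≢ colour u w

    open Colouring

    MissingAt : ∀ {H} → Colouring H → Fin n → ℕ → Set
    MissingAt {H} κ u c = ∀ {x} → Graph._~_ H u x → c ≢ colour κ u x

    Free : ∀ {H} → Colouring H → Fin n × Fin n → ℕ → Set
    Free κ (a , b) c = c ∈ lists a b × MissingAt κ a c × MissingAt κ b c

    module _ {H : Graph n} (e : Fin n × Fin n) (c : ℕ) (κ : Colouring (H ∖ e)) (free : Free κ e c) where
      open Graph H

      recolour : Fin n → Fin n → ℕ
      recolour u v with joins? e u v
      ... | yes _ = c
      ... | no _  = colour κ u v

      missing : ∀ {u v} → Joins e u v → MissingAt κ u c
      missing (inj₁ (refl , _)) = proj₁ (proj₂ free)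
      missing (inj₂ (refl , _)) = proj₂ (proj₂ free)

      insert : Colouring H
      insert .colour = recolour
      insert .colour-sym u v with joins? e u v | joins? e v u
      ... | yes _ | yes _ = refl
      ... | yes p | no ¬p = contradiction (Joins-sym e p) ¬p
      ... | no ¬p | yes p = contradiction (Joins-sym e p) ¬p
      ... | no _  | no _  = colour-sym κ u v
      insert .listed {u} {v} u~v with joins? e u v
      ... | yes (inj₁ (refl , refl)) = proj₁ free
      ... | yes (inj₂ (refl , refl)) = subst (c ∈_) (symm v u) (proj₁ free)
      ... | no ¬p = listed κ (u~v , ¬p)
      insert .proper {u} {v} {w} u~v u~w v≢w with joins? e u v | joins? e u w
      ... | yes p | yes q = contradiction (Joins-unique e p q) v≢w
      ... | yes p | no ¬q = missing p (u~w , ¬q)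
      ... | no ¬p | yes q = missing q (u~v , ¬p) ∘ sym
      ... | no ¬p | no ¬q = proper κ (u~v , ¬p) (u~w , ¬q) v≢w

      insert-missing : ∀ {u c′} → (∀ {v} → Joins e u v → c ≢ c′) →
        MissingAt κ u c′ → MissingAt insert u c′
      insert-missing {u} c≢c′ missing {x} u~x with joins? e u x
      ... | yes p = c≢c′ p ∘ sym
      ... | no ¬p = missing (u~x , ¬p)

      insert-free : ∀ {e′ c′} → (Meets e e′ → c ≢ c′) → Free κ e′ c′ → Free insert e′ c′
      insert-free c≢c′ (c′∈ , missing-a , missing-b) = c′∈ ,
        insert-missing (λ { (inj₁ (refl , _)) → c≢c′ (inj₁ (inj₁ refl))
                          ; (inj₂ (refl , _)) → c≢c′ (inj₂ (inj₁ refl)) }) missing-a ,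
        insert-missing (λ { (inj₁ (refl , _)) → c≢c′ (inj₁ (inj₂ refl))
                          ; (inj₂ (refl , _)) → c≢c′ (inj₂ (inj₂ refl)) }) missing-b

    -- Freeness is checked against `κ` alone: an inserted colour can only disturb later edges that
    -- meet it, and those receive other colours.
    extend : ∀ {H} S (κ : Colouring (H ∖∖ map proj₁ S)) → All (λ (e , c) → Free κ e c) S →
      AllPairs (λ (e , c) (e′ , c′) → Meets e e′ → c ≢ c′) S → Colouring H
    extend [] κ _ _ = κ
    extend ((e , c) ∷ S) κ (free ∷ frees) (compatible ∷ pairs) =
      extend S (insert e c κ free)
        (All.zipWith (λ (≢c , free′) → insert-free e c κ free ≢c free′) (compatible , frees)) pairs

    module _ {H : Graph n} (κ : Colouring H) where

      seen : Fin n → List ℕ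
      seen u = map (colour κ u) (nbrs H u)

      residual : Fin n → Fin n → List ℕ
      residual u v = filter (_∉ℕ? seen u ++ seen v) (lists u v)

      residual-unique : ∀ u v → Unique (residual u v)
      residual-unique u v = Unique.filter⁺ (_∉ℕ? seen u ++ seen v) (unique u v)

      residual-free : ∀ {u v c} → c ∈ residual u v → Free κ (u , v) c
      residual-free {u} {v} c∈ =
        let c∈L , c∉ = ∈-filter⁻ (_∉ℕ? seen u ++ seen v) {xs = lists u v} c∈
        in c∈L ,
           (λ { u~x refl → c∉ (∈-++⁺ˡ (∈-map⁺ (colour κ u) (∈-nbrs⁺ H u~x))) }) ,
           (λ { v~x refl → c∉ (∈-++⁺ʳ (seen u) (∈-map⁺ (colour κ v) (∈-nbrs⁺ H v~x))) })

      residual-length : ∀ {u v} k → k + (deg H u + deg H v) ≤ length (lists u v) →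
        k ≤ length (residual u v)
      residual-length {u} {v} k le = +-cancelʳ-≤ (deg H u + deg H v) k _
        (≤-trans le (subst (λ m → length (lists u v) ≤ length (residual u v) + m)
          (trans (length-++ (seen u))
            (cong₂ _+_ (length-map (colour κ u) (nbrs H u)) (length-map (colour κ v) (nbrs H v))))
          (length-remove ℕ._≟_ (lists u v) (seen u ++ seen v) (unique u v))))

-- Reducible configurations

module _ {n : ℕ} (H : Graph n) (L : Lists {n}) (D : ℕ)
  (long : ∀ {u v} → Graph._~_ H u v → suc D ≤ length (Lists.lists L u v)) where
  open Graph H

  pattern fwd = here (inj₁ (refl , refl))
  pattern bwd = here (inj₂ (refl , refl))

  -- At least `a` and `b` edges are deleted at the two ends, so at most j + D - a - b colours are
  -- seen there, and 1 + a + b - j of the D + 1 listed colours remain.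
  residual-enough : ∀ es {u v j a b k} (κ : Colouring L (H ∖∖ es)) → u ~ v →
    deg H u + deg H v ≤ j + D →
    a + deg (H ∖∖ es) u ≤ deg H u → b + deg (H ∖∖ es) v ≤ deg H v →
    k + j ≡ suc (a + b) → k ≤ length (residual L κ u v)
  residual-enough es {u} {v} {j} {a} {b} {k} κ u~v sum≤ a≤ b≤ eq = residual-length L κ k
    (≤-trans (+-cancelˡ-≤ (a + b) _ _ (begin
      (a + b) + (k + (d′ u + d′ v)) ≡⟨ shuffle a b k (d′ u) (d′ v) ⟩
      k + ((a + d′ u) + (b + d′ v)) ≤⟨ +-monoʳ-≤ k (≤-trans (+-mono-≤ a≤ b≤) sum≤) ⟩
      k + (j + D)                   ≡⟨ +-assoc k j D ⟨
      (k + j) + D                   ≡⟨ cong (_+ D) eq ⟩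
      suc (a + b) + D               ≡⟨ +-suc (a + b) D ⟨
      (a + b) + suc D               ∎)) (long u~v))
    where
    open ≤-Reasoning
    d′ = deg (H ∖∖ es)
    shuffle : ∀ a b k x y → (a + b) + (k + (x + y)) ≡ k + ((a + x) + (b + y))
    shuffle = solve-∀

  private
    -- Edges without a common vertex impose no condition on each other's colours.
    apart : ∀ {a b c d : Fin n} {X : Set} → a ≢ c → a ≢ d → b ≢ c → b ≢ d → Meets (a , b) (c , d) → X
    apart p q r s (inj₁ (inj₁ eq)) = contradiction eq p
    apart p q r s (inj₁ (inj₂ eq)) = contradiction eq q
    apart p q r s (inj₂ (inj₁ eq)) = contradiction eq r
    apart p q r s (inj₂ (inj₂ eq)) = contradiction eq s

    two : ∀ {a b : Fin n} → a ≢ b → Unique (a ∷ b ∷ [])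
    two p = (p ∷ []) ∷ [] ∷ []

    three : ∀ {a b c : Fin n} → a ≢ b → a ≢ c → b ≢ c → Unique (a ∷ b ∷ c ∷ [])
    three p q r = (p ∷ q ∷ []) ∷ (r ∷ []) ∷ [] ∷ []

  module _ (smaller : ∀ {a b} es → a ~ b → Colouring L (H ∖∖ ((a , b) ∷ es))) where

    -- The edge is adjacent to at most D others and has D + 1 colours.
    edge-reducible : ∀ {v w} → v ~ w → deg H v + deg H w ≤ 2 + D →
      Colouring L H
    edge-reducible {v} {w} vw sum≤ =
      let c , c∈ , _ = pick ℕ._≟_ [] (residual-unique L κ v w)
                         (residual-enough es κ vw sum≤
                           (deg-∖∖ H es ([] ∷ []) ((vw , fwd) ∷ []))
                           (deg-∖∖ H es ([] ∷ []) ((~-sym vw , bwd) ∷ [])) refl)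
      in extend L {H = H} (((v , w) , c) ∷ []) κ (residual-free L κ c∈ ∷ []) ([] ∷ [])
      where
      es′ = []
      es = (v , w) ∷ es′
      κ : Colouring L (H ∖∖ es)
      κ = smaller es′ vw

    -- Two edges are deleted at each corner, so each edge keeps 1 + 2 + 2 - 3 = 2 colours.
    square-reducible : ∀ {v w x w′} → v ~ w → w ~ x → x ~ w′ → w′ ~ v → v ≢ x → w ≢ w′ →
      deg H v + deg H w ≤ 3 + D → deg H w + deg H x ≤ 3 + D →
      deg H x + deg H w′ ≤ 3 + D → deg H w′ + deg H v ≤ 3 + D →
      Colouring L H
    square-reducible {v} {w} {x} {w′} vw wx xw′ w′v v≢x w≢w′ s₁ s₂ s₃ s₄ =
      case square-choosable
            (residual-unique L κ v w) (residual-unique L κ w x)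
            (residual-unique L κ x w′) (residual-unique L κ w′ v)
            (residual-enough es κ vw s₁ at-v at-w refl) (residual-enough es κ wx s₂ at-w at-x refl)
            (residual-enough es κ xw′ s₃ at-x at-w′ refl) (residual-enough es κ w′v s₄ at-w′ at-v refl)
      of λ { (a , b , c , d , a∈ , b∈ , c∈ , d∈ , a≢b , b≢c , c≢d , d≢a) →
         extend L {H = H} (((v , w) , a) ∷ ((w , x) , b) ∷ ((x , w′) , c) ∷ ((w′ , v) , d) ∷ []) κ
           (residual-free L κ a∈ ∷ residual-free L κ b∈ ∷ residual-free L κ c∈ ∷ residual-free L κ d∈ ∷ [])
           (((λ _ → a≢b) ∷ apart v≢x v≢w′ w≢x w≢w′ ∷ (λ _ → d≢a ∘ sym) ∷ []) ∷
            ((λ _ → b≢c) ∷ apart w≢w′ (≢-sym v≢w) (≢-sym w′≢x) (≢-sym v≢x) ∷ []) ∷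
            ((λ _ → c≢d) ∷ []) ∷ [] ∷ []) }
      where
      es′ = (w , x) ∷ (x , w′) ∷ (w′ , v) ∷ []
      es = (v , w) ∷ es′
      κ : Colouring L (H ∖∖ es)
      κ = smaller es′ vw
      v≢w : v ≢ w
      v≢w eq = ~-irrefl eq vw
      w≢x : w ≢ x
      w≢x eq = ~-irrefl eq wx
      w′≢x : w′ ≢ x
      w′≢x eq = ~-irrefl (sym eq) xw′
      v≢w′ : v ≢ w′
      v≢w′ eq = ~-irrefl (sym eq) w′v
      at-v : 2 + deg (H ∖∖ es) v ≤ deg H v
      at-v = deg-∖∖ H es (two w≢w′) ((vw , fwd) ∷ (~-sym w′v , there (there (there bwd))) ∷ [])
      at-w : 2 + deg (H ∖∖ es) w ≤ deg H w
      at-w = deg-∖∖ H es (two v≢x) ((~-sym vw , bwd) ∷ (wx , there fwd) ∷ [])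
      at-x : 2 + deg (H ∖∖ es) x ≤ deg H x
      at-x = deg-∖∖ H es (two w≢w′) ((~-sym wx , there bwd) ∷ (xw′ , there (there fwd)) ∷ [])
      at-w′ : 2 + deg (H ∖∖ es) w′ ≤ deg H w′
      at-w′ = deg-∖∖ H es (two v≢x) ((w′v , there (there (there fwd))) ∷ (~-sym xw′ , there (there bwd)) ∷ [])

    -- Three edges are deleted at `v`, two at `w` and `x`, one at `y`: the edges vw and xv keep
    -- three colours, wx and vy keep two.
    paw-reducible : ∀ {v w x y} → v ~ w → w ~ x → x ~ v → v ~ y → w ≢ y → x ≢ y →
      deg H v + deg H w ≤ 3 + D → deg H w + deg H x ≤ 3 + D →
      deg H x + deg H v ≤ 3 + D → deg H v + deg H y ≤ 3 + D →
      Colouring L H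
    paw-reducible {v} {w} {x} {y} vw wx xv vy w≢y x≢y s₁ s₂ s₃ s₄ =
      case paw-choosable
            (residual-unique L κ v y) (residual-unique L κ v w)
            (residual-unique L κ w x) (residual-unique L κ x v)
            (residual-enough es κ vy s₄ at-v at-y refl) (residual-enough es κ vw s₁ at-v at-w refl)
            (residual-enough es κ wx s₂ at-w at-x refl) (residual-enough es κ xv s₃ at-x at-v refl)
      of λ { (a , b , c , d , a∈ , b∈ , c∈ , d∈ , a≢b , a≢d , b≢c , b≢d , c≢d) →
         extend L {H = H} (((v , w) , b) ∷ ((w , x) , c) ∷ ((x , v) , d) ∷ ((v , y) , a) ∷ []) κ
           (residual-free L κ b∈ ∷ residual-free L κ c∈ ∷ residual-free L κ d∈ ∷ residual-free L κ a∈ ∷ [])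
           (((λ _ → b≢c) ∷ (λ _ → b≢d) ∷ (λ _ → a≢b ∘ sym) ∷ []) ∷
            ((λ _ → c≢d) ∷ apart (≢-sym v≢w) w≢y x≢v x≢y ∷ []) ∷
            ((λ _ → a≢d ∘ sym) ∷ []) ∷ [] ∷ []) }
      where
      es′ = (w , x) ∷ (x , v) ∷ (v , y) ∷ []
      es = (v , w) ∷ es′
      κ : Colouring L (H ∖∖ es)
      κ = smaller es′ vw
      v≢w : v ≢ w
      v≢w eq = ~-irrefl eq vw
      w≢x : w ≢ x
      w≢x eq = ~-irrefl eq wx
      x≢v : x ≢ v
      x≢v eq = ~-irrefl eq xv
      at-v : 3 + deg (H ∖∖ es) v ≤ deg H v
      at-v = deg-∖∖ H es (three w≢x w≢y x≢y)
        ((vw , fwd) ∷ (~-sym xv , there (there bwd)) ∷ (vy , there (there (there fwd))) ∷ [])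
      at-w : 2 + deg (H ∖∖ es) w ≤ deg H w
      at-w = deg-∖∖ H es (two (≢-sym x≢v)) ((~-sym vw , bwd) ∷ (wx , there fwd) ∷ [])
      at-x : 2 + deg (H ∖∖ es) x ≤ deg H x
      at-x = deg-∖∖ H es (two (≢-sym v≢w)) ((~-sym wx , there bwd) ∷ (xv , there (there fwd)) ∷ [])
      at-y : 1 + deg (H ∖∖ es) y ≤ deg H y
      at-y = deg-∖∖ H es ([] ∷ []) ((~-sym vy , there (there (there bwd))) ∷ [])

    -- Three edges are deleted at `v` and `w`, two at `x` and `y`: the chord vw keeps four colours,
    -- yw and wx keep three, and vx and vy, with the weaker bound D + 4, keep two.
    diamond-reducible : ∀ {v w x y} → v ~ w → v ~ x → v ~ y → y ~ w → w ~ x → x ≢ y →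
      deg H v + deg H w ≤ 3 + D → deg H v + deg H x ≤ 4 + D → deg H v + deg H y ≤ 4 + D →
      deg H y + deg H w ≤ 3 + D → deg H w + deg H x ≤ 3 + D →
      Colouring L H
    diamond-reducible {v} {w} {x} {y} vw vx vy yw wx x≢y s₀ s₁ s₂ s₃ s₄ =
      case diamond-choosable
            (residual-unique L κ v w) (residual-unique L κ v x) (residual-unique L κ v y)
            (residual-unique L κ y w) (residual-unique L κ w x)
            (residual-enough es κ vw s₀ at-v at-w refl)
            (residual-enough es κ vx s₁ at-v at-x refl) (residual-enough es κ vy s₂ at-v at-y refl)
            (residual-enough es κ yw s₃ at-y at-w refl) (residual-enough es κ wx s₄ at-w at-x refl)
      of λ { (h , a , b , c , d , h∈ , a∈ , b∈ , c∈ , d∈ , h≢a , h≢b , h≢c , h≢d , a≢b , b≢c , c≢d , d≢a) →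
         extend L {H = H} (((v , w) , h) ∷ ((v , x) , a) ∷ ((v , y) , b) ∷ ((y , w) , c) ∷ ((w , x) , d) ∷ []) κ
           (residual-free L κ h∈ ∷ residual-free L κ a∈ ∷ residual-free L κ b∈ ∷
            residual-free L κ c∈ ∷ residual-free L κ d∈ ∷ [])
           (((λ _ → h≢a) ∷ (λ _ → h≢b) ∷ (λ _ → h≢c) ∷ (λ _ → h≢d) ∷ []) ∷
            ((λ _ → a≢b) ∷ apart v≢y v≢w x≢y (≢-sym w≢x) ∷ (λ _ → d≢a ∘ sym) ∷ []) ∷
            ((λ _ → b≢c) ∷ apart v≢w v≢x y≢w (≢-sym x≢y) ∷ []) ∷
            ((λ _ → c≢d) ∷ []) ∷ [] ∷ []) }
      where
      es′ = (v , x) ∷ (v , y) ∷ (y , w) ∷ (w , x) ∷ []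
      es = (v , w) ∷ es′
      κ : Colouring L (H ∖∖ es)
      κ = smaller es′ vw
      v≢w : v ≢ w
      v≢w eq = ~-irrefl eq vw
      v≢x : v ≢ x
      v≢x eq = ~-irrefl eq vx
      v≢y : v ≢ y
      v≢y eq = ~-irrefl eq vy
      y≢w : y ≢ w
      y≢w eq = ~-irrefl eq yw
      w≢x : w ≢ x
      w≢x eq = ~-irrefl eq wx
      at-v : 3 + deg (H ∖∖ es) v ≤ deg H v
      at-v = deg-∖∖ H es (three w≢x (≢-sym y≢w) x≢y)
        ((vw , fwd) ∷ (vx , there fwd) ∷ (vy , there (there fwd)) ∷ [])
      at-w : 3 + deg (H ∖∖ es) w ≤ deg H w
      at-w = deg-∖∖ H es (three v≢y v≢x (≢-sym x≢y))
        ((~-sym vw , bwd) ∷ (~-sym yw , there (there (there bwd))) ∷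
         (wx , there (there (there (there fwd)))) ∷ [])
      at-x : 2 + deg (H ∖∖ es) x ≤ deg H x
      at-x = deg-∖∖ H es (two v≢w) ((~-sym vx , there bwd) ∷ (~-sym wx , there (there (there (there bwd)))) ∷ [])
      at-y : 2 + deg (H ∖∖ es) y ≤ deg H y
      at-y = deg-∖∖ H es (two v≢w) ((~-sym vy , there (there bwd)) ∷ (yw , there (there (there fwd))) ∷ [])

-- Elimination orders

module _ {n : ℕ} {P : Fin n → Set} (P? : U.Decidable P) (f : Fin n → ℕ) where

  ∃-maximal : ∃ P → ∃[ v ] (P v × ∀ {u} → P u → f u ≤ f v)
  ∃-maximal (x , px) = argmax f x xs , argmax-all f px (All.all-filter P? (allFin n)) ,
    λ pu → All.lookup (f[xs]≤f[argmax] {f = f} x xs) (∈-filter⁺ P? (∈-allFin _) pu)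
    where xs = filter P? (allFin n)

  ∃-minimal : ∃ P → ∃[ v ] (P v × ∀ {u} → P u → f v ≤ f u)
  ∃-minimal (x , px) = argmin f x xs , argmin-all f px (All.all-filter P? (allFin n)) ,
    λ pu → All.lookup (f[argmin]≤f[xs] {f = f} x xs) (∈-filter⁺ P? (∈-allFin _) pu)
    where xs = filter P? (allFin n)

-- A larger rank means earlier elimination.
record Elimination {n : ℕ} (k : ℕ) (H : Graph n) : Set where
  open Graph H
  field
    rank           : Fin n → ℕ
    rank-injective : ∀ {u v} → rank u ≡ rank v → u ≡ v
    lower          : Fin n → List (Fin n)
    lower-length   : ∀ v → length (lower v) ≤ k
    lower-adjacent : ∀ {u v} → u ~ v → rank u < rank v → u ∈ lower v
    lower-shared   : ∀ {u v w} → u ∈ lower w → v ∈ lower w → rank u < rank v → u ∈ lower v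

Elimination-∖∖ : ∀ {n k} {H : Graph n} es → Elimination k H → Elimination k (H ∖∖ es)
Elimination-∖∖ {H = H} es E = record
  { Elimination E
  ; lower-adjacent = Elimination.lower-adjacent E ∘ ∖∖⇒~ H es }

-- Finding a reducible configuration.

module _ {n : ℕ} (L : Lists {n}) (D : ℕ) where
  open DecMembership (Fin._≟_ {n}) using (_∈?_; _∉?_)

  module Step (H : Graph n) (E : Elimination 3 H)
    (long : ∀ {u v} → Graph._~_ H u v → suc D ≤ length (Lists.lists L u v))
    (deg≤D : ∀ u → deg H u ≤ D)
    (smaller : ∀ {a b} es → Graph._~_ H a b → Colouring L (H ∖∖ ((a , b) ∷ es))) where
    open Graph H
    open Elimination E

    -- Some neighbour of `v` is eliminated before it; the first such vertex is the one of largest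
    -- rank.
    Inner : Fin n → Set
    Inner v = ∃[ w ] (v ~ w × rank v < rank w)

    inner? : ∀ v → Dec (Inner v)
    inner? v = Fin.any? λ w → (v ~? w) ×-dec (rank v ℕ.<? rank w)

    others : Fin n → Fin n → List (Fin n)
    others u v = filter (_∉? v ∷ []) (nbrs H u)

    others-unique : ∀ u v → Unique (others u v)
    others-unique u v = Unique.filter⁺ (_∉? v ∷ []) (nbrs-unique H u)

    ∈-others⁻ : ∀ {u v x} → x ∈ others u v → u ~ x × x ≢ v
    ∈-others⁻ {u} {v} x∈ =
      let x∈nbrs , x∉ = ∈-filter⁻ (_∉? v ∷ []) {xs = nbrs H u} x∈
      in ∈-nbrs⁻ H x∈nbrs , x∉ ∘ here

    deg≤others : ∀ u v → deg H u ≤ suc (length (others u v))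
    deg≤others u v = subst (deg H u ≤_) (+-comm _ 1)
      (length-remove Fin._≟_ (nbrs H u) (v ∷ []) (nbrs-unique H u))

    ~⇒≢ : ∀ {u v} → u ~ v → u ≢ v
    ~⇒≢ u~v u≡v = ~-irrefl u≡v u~v

    rank-≢ : ∀ {u v} → u ≢ v → rank u ≤ rank v → rank u < rank v
    rank-≢ u≢v le = ≤∧≢⇒< le (u≢v ∘ rank-injective)

    module _ {v : Fin n} (v-max : ∀ {u} → Inner u → rank u ≤ rank v) where

      module Outer {w : Fin n} (v~w : v ~ w) (v<w : rank v < rank w) where

        -- A neighbour of larger rank would make `w` inner, although `w` ranks above `v`.
        nbr-lower : ∀ {x} → w ~ x → rank x < rank w
        nbr-lower {x} w~x with rank x ℕ.<? rank w
        ... | yes lt = lt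
        ... | no ¬lt = contradiction v<w (≤⇒≯ (v-max (x , w~x , rank-≢ (~⇒≢ w~x) (≮⇒≥ ¬lt))))

        nbrs⊆lower : ∀ {x} → x ∈ nbrs H w → x ∈ lower w
        nbrs⊆lower x∈ = lower-adjacent (~-sym (∈-nbrs⁻ H x∈)) (nbr-lower (∈-nbrs⁻ H x∈))

        deg≤3 : deg H w ≤ 3
        deg≤3 = ≤-trans (Unique-⊆⇒length-≤ Fin._≟_ (nbrs-unique H w) nbrs⊆lower) (lower-length w)

        -- Such an `x` is inner because of `w`, so it ranks below `v`; as both lie in `lower w`,
        -- `lower-shared` applies.
        others⊆lower : others w v ⊆ lower v
        others⊆lower x∈ =
          let w~x , x≢v = ∈-others⁻ x∈
              x<w = nbr-lower w~x
          in lower-shared (nbrs⊆lower (∈-nbrs⁺ H w~x)) (nbrs⊆lower (∈-nbrs⁺ H (~-sym v~w)))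
               (rank-≢ x≢v (v-max (w , ~-sym w~x , x<w)))

        sum≤ : ∀ u → deg H w + deg H u ≤ 3 + D
        sum≤ u = +-mono-≤ deg≤3 (deg≤D u)

        sum≤′ : ∀ u → deg H u + deg H w ≤ 3 + D
        sum≤′ u = subst (_≤ 3 + D) (+-comm (deg H w) (deg H u)) (sum≤ u)

        -- The sum is at least D + 3: bounding d(v) by D gives this, and bounding d(w) by 3 gives
        -- `D≤deg`.
        3≤deg : ¬ deg H v + deg H w ≤ 2 + D → 3 ≤ deg H w
        3≤deg big = +-cancelʳ-≤ D 3 _ (≤-trans (≰⇒> big)
          (subst (_≤ deg H w + D) (+-comm (deg H w) (deg H v)) (+-monoʳ-≤ (deg H w) (deg≤D v))))

        D≤deg : ¬ deg H v + deg H w ≤ 2 + D → D ≤ deg H v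
        D≤deg big = +-cancelˡ-≤ 3 D _ (≤-trans (≰⇒> big)
          (subst (deg H v + deg H w ≤_) (+-comm (deg H v) 3) (+-monoʳ-≤ (deg H v) deg≤3)))

        2≤others : 3 ≤ deg H w → 2 ≤ length (others w v)
        2≤others le = ≤-pred (≤-trans le (deg≤others w v))

      -- Two pairs among the at most three members of `lower v` share a vertex `x`, which closes a
      -- 4-cycle. Each of its edges ends at `w` or `w′`, of degree at most three.
      via-square : ∀ {w w′} → v ~ w → rank v < rank w → v ~ w′ → rank v < rank w′ → w ≢ w′ →
        2 ≤ length (others w v) → 2 ≤ length (others w′ v) → Colouring L H
      via-square {w} {w′} v~w v<w v~w′ v<w′ w≢w′ 2≤w 2≤w′ =
        let x , x∈w , x∈w′ = common Fin._≟_ (others-unique w v) (others-unique w′ v)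
              (Outer.others⊆lower v~w v<w) (Outer.others⊆lower v~w′ v<w′)
              (≤-trans (s≤s (lower-length v)) (+-mono-≤ 2≤w 2≤w′))
            w~x , x≢v = ∈-others⁻ x∈w
            w′~x , _ = ∈-others⁻ x∈w′
        in square-reducible H L D long smaller v~w w~x (~-sym w′~x) (~-sym v~w′) (≢-sym x≢v) w≢w′
             (Outer.sum≤′ v~w v<w v) (Outer.sum≤ v~w v<w x)
             (Outer.sum≤′ v~w′ v<w′ x) (Outer.sum≤ v~w′ v<w′ v)

      module _ {w : Fin n} (v~w : v ~ w) (v<w : rank v < rank w)
        (others⊆ : others v w ⊆ lower v)
        (3≤deg-w : 3 ≤ deg H w) (D≤deg-v : D ≤ deg H v) where
        open Outer v~w v<w

        D≤others : D ≤ suc (length (others v w))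
        D≤others = ≤-trans D≤deg-v (deg≤others v w)

        others≤3 : length (others v w) ≤ 3
        others≤3 = ≤-trans (Unique-⊆⇒length-≤ Fin._≟_ (others-unique v w) others⊆) (lower-length v)

        -- Here D = 3. Both `v` and `w` have two further neighbours in `lower v`, hence a common
        -- one, `x`; another neighbour `y` of `v` gives the pendant edge.
        via-paw : D ≤ 3 → Colouring L H
        via-paw D≤3 =
          let 2≤v : 2 ≤ length (others v w)
              2≤v = ≤-pred (≤-trans (≤-trans 3≤deg-w (deg≤D w)) D≤others)
              x , x∈w , x∈v = common Fin._≟_ (others-unique w v) (others-unique v w)
                others⊆lower others⊆
                (≤-trans (s≤s (lower-length v)) (+-mono-≤ (2≤others 3≤deg-w) 2≤v))
              y , y∈v , y≢x = pick Fin._≟_ (x ∷ []) (others-unique v w) 2≤v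
              w~x , x≢v = ∈-others⁻ x∈w
              v~x , x≢w = ∈-others⁻ x∈v
              v~y , y≢w = ∈-others⁻ y∈v
          in paw-reducible H L D long smaller v~w w~x (~-sym v~x) v~y (≢-sym y≢w) (y≢x ∘ here ∘ sym)
               (sum≤′ v) (sum≤ x) (low x v) (low v y)
          where
          low : ∀ a b → deg H a + deg H b ≤ 3 + D
          low a b = +-mono-≤ (≤-trans (deg≤D a) D≤3) (deg≤D b)

        -- At least three neighbours of `v` besides `w` lie in `lower v`, so they fill it and D = 4.
        -- Two further neighbours of `w` are then adjacent to `v` as well, and vw is the chord.
        via-diamond : 4 ≤ D → Colouring L H
        via-diamond 4≤D =
          let x , x∈w , _ = pick Fin._≟_ [] (others-unique w v) (<⇒≤ (2≤others 3≤deg-w))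
              y , y∈w , y∉ = pick Fin._≟_ (x ∷ []) (others-unique w v) (2≤others 3≤deg-w)
              w~x , x≢v = ∈-others⁻ x∈w
              w~y , y≢v = ∈-others⁻ y∈w
          in diamond-reducible H L D long smaller v~w (others-adjacent x∈w) (others-adjacent y∈w) (~-sym w~y) w~x
               (y∉ ∘ here ∘ sym)
               (sum≤′ v) (low v x) (low v y) (sum≤′ y) (sum≤ x)
          where
          low : ∀ a b → deg H a + deg H b ≤ 4 + D
          low a b = +-mono-≤ (≤-trans (deg≤D a) (≤-trans D≤others (s≤s others≤3))) (deg≤D b)
          -- three other neighbours of v already exhaust lower v
          others-adjacent : ∀ {x} → x ∈ others w v → v ~ x
          others-adjacent {x} x∈ with x ∈? others v w
          ... | yes x∈v = proj₁ (∈-others⁻ x∈v)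
          ... | no x∉v = contradiction
            (≤-trans (Unique-⊆⇒length-≤ Fin._≟_ (All.tabulate (λ y∈ → ∈∉⇒≢ y∈ x∉v ∘ sym) AllPairs.∷ others-unique v w)
              λ { (here refl) → others⊆lower x∈ ; (there y∈) → others⊆ y∈ })
              (lower-length v))
            (<⇒≱ (≤-trans 4≤D D≤others))

      at-maximal : Inner v → Colouring L H
      at-maximal (w , v~w , v<w) with deg H v + deg H w ℕ.≤? 2 + D
      ... | yes small = edge-reducible H L D long smaller v~w small
      ... | no big with Any.any? (λ x → rank v ℕ.<? rank x) (others v w)
      -- As `w` is the only neighbour of larger rank, all others lie in `lower v`.
      ...   | no none = case D ℕ.≤? 3 of λ
        { (yes D≤3) → via-paw v~w v<w others⊆ (3≤deg big) (D≤deg big) D≤3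
        ; (no D≰3)  → via-diamond v~w v<w others⊆ (3≤deg big) (D≤deg big) (≰⇒> D≰3) }
        where
        open Outer v~w v<w
        others⊆ : others v w ⊆ lower v
        others⊆ x∈ = let v~x , _ = ∈-others⁻ x∈ in
          lower-adjacent (~-sym v~x) (rank-≢ (≢-sym (~⇒≢ v~x)) (≮⇒≥ (none ∘ lose x∈)))
      ...   | yes some with find some
      ...     | w′ , w′∈ , v<w′ with deg H v + deg H w′ ℕ.≤? 2 + D | ∈-others⁻ w′∈
      ...       | yes small | v~w′ , _ = edge-reducible H L D long smaller v~w′ small
      ...       | no big′ | v~w′ , w′≢w = via-square v~w v<w v~w′ v<w′ (≢-sym w′≢w)
        (Outer.2≤others v~w v<w (Outer.3≤deg v~w v<w big))
        (Outer.2≤others v~w′ v<w′ (Outer.3≤deg v~w′ v<w′ big′))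

    step : Colouring L H
    step with Fin.any? inner?
    ... | yes some = let v , inner , v-max = ∃-maximal inner? rank some in at-maximal v-max inner
    -- The end of smaller rank of any edge is inner, so the graph is edgeless and the constant 0
    -- will do.
    ... | no none = record
      { colour     = λ _ _ → 0
      ; colour-sym = λ _ _ → refl
      ; listed     = λ u~v → contradiction u~v edgeless
      ; proper     = λ u~v _ _ → contradiction u~v edgeless
      }
      where
      edgeless : ∀ {u v} → ¬ u ~ v
      edgeless {u} {v} u~v with <-cmp (rank u) (rank v)
      ... | tri< lt _ _ = none (u , v , u~v , lt)
      ... | tri≈ _ eq _ = ~⇒≢ u~v (rank-injective eq)
      ... | tri> _ _ gt = none (v , u , ~-sym u~v , gt)

  deg-∖∖-≤ : ∀ (H : Graph n) es u → deg (H ∖∖ es) u ≤ deg H u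
  deg-∖∖-≤ H es u = deg-∖∖ H es [] []

  -- Induction on the number of arcs, with `D` fixed: deletion preserves the elimination order, the
  -- list lengths and the degree bound.
  colourable : ∀ (H : Graph n) → Elimination 3 H →
    (∀ {u v} → Graph._~_ H u v → suc D ≤ length (Lists.lists L u v)) →
    (∀ u → deg H u ≤ D) → Colouring L H
  colourable H = go H (<-wellFounded _)
    where
    go : ∀ H → Acc _<_ (length (arcs H)) → Elimination 3 H →
      (∀ {u v} → Graph._~_ H u v → suc D ≤ length (Lists.lists L u v)) →
      (∀ u → deg H u ≤ D) → Colouring L H
    go H (acc rec) E long deg≤D = Step.step H E long deg≤D λ {a} {b} es a~b →
      let es′ = (a , b) ∷ es in
      go (H ∖∖ es′) (rec (arcs-∖∖ H es a~b)) (Elimination-∖∖ es′ E)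
        (long ∘ ∖∖⇒~ H es′) (λ u → ≤-trans (deg-∖∖-≤ H es′ u) (deg≤D u))

-- Elimination orders from tree decompositions

length≤∣∣ : ∀ {n} {xs : List (Fin n)} {p : Subset n} → Unique xs → All (_∈ₛ p) xs → length xs ≤ ∣ p ∣
length≤∣∣ [] _ = z≤n
length≤∣∣ (x≢ ∷ uxs) (x∈ ∷ xs∈) = ≤-trans
  (s≤s (length≤∣∣ uxs (All.zipWith (λ (x≢y , y∈) → Subset.x∈p∧x≢y⇒x∈p-y y∈ (≢-sym x≢y)) (x≢ , xs∈))))
  (Subset.x∈p⇒∣p-x∣<∣p∣ x∈)

module _ {p} {P : ℕ → Set p} (P? : U.Decidable P) where

  ∃-least : ∀ k → P k → ∃[ m ] (m ≤ k × P m × ∀ j → P j → m ≤ j)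
  ∃-least k pk = go k pk ≤-refl (<-wellFounded k)
    where
    go : ∀ i → P i → i ≤ k → Acc _<_ i → ∃[ m ] (m ≤ k × P m × ∀ j → P j → m ≤ j)
    go i pi i≤k (acc rec) with anyUpTo? P? i
    ... | yes (j , j<i , pj) = go j pj (≤-trans (<⇒≤ j<i) i≤k) (rec j<i)
    ... | no none = i , i≤k , pi , λ j pj → ≮⇒≥ λ j<i → none (j , j<i , pj)

module _ {n : ℕ} (G : Graph n) where
  open Graph G
  open DecMembership (Fin._≟_ {n}) using (_∈?_)

  simple-suffix : ∀ {u v w} (p : Star _~_ u v) → Unique (vertices G p) → w ∈ vertices G p →
    ∃[ q ] Unique (vertices G {w} {v} q)
  simple-suffix ε       uniq       (here refl)  = ε , uniq
  simple-suffix (s ◅ p) uniq       (here refl)  = s ◅ p , uniq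
  simple-suffix (s ◅ p) (_ ∷ uniq) (there w∈)   = simple-suffix p uniq w∈

  -- When `u` recurs on the erased remainder, the suffix from that occurrence is taken instead.
  loop-erase : ∀ {u v} → Star _~_ u v → ∃[ p ] Unique (vertices G {u} {v} p)
  loop-erase ε = ε , [] ∷ []
  loop-erase {u} (s ◅ p) with loop-erase p
  ... | q , uniq with u ∈? vertices G q
  ...   | yes u∈ = simple-suffix q uniq u∈
  ...   | no u∉  = s ◅ q , All.tabulate (λ x∈ → ∈∉⇒≢ x∈ u∉ ∘ sym) ∷ uniq

  vertices-nonempty : ∀ {u v} (p : Star _~_ u v) → 1 ≤ length (vertices G p)
  vertices-nonempty ε       = s≤s z≤n
  vertices-nonempty (_ ◅ _) = s≤s z≤n

  vertices-map : ∀ e {u v} (p : Star (Graph._~_ (G ∖ e)) u v) →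
    vertices G (Star.map proj₁ p) ≡ vertices (G ∖ e) p
  vertices-map e ε       = refl
  vertices-map e (_ ◅ p) = cong (_ ∷_) (vertices-map e p)

-- Depth in a rooted tree.

module _ {m : ℕ} (T : Graph m) (isTree : IsTree T) where
  open Graph T
  open IsTree isTree

  -- After loop erasure the walk is a path on at least three vertices, which the edge ab closes to a
  -- cycle.
  bridge : ∀ {a b} → a ~ b → ¬ Star (Graph._~_ (T ∖ (a , b))) a b
  bridge {a} {b} a~b walk with loop-erase (T ∖ (a , b)) walk
  ... | ε , _                   = ~-irrefl refl a~b
  ... | (_ , ¬ab) ◅ ε , _       = ¬ab (inj₁ (refl , refl))
  ... | p@(_ ◅ _ ◅ q) , uniq = acyclic record
    { path     = Star.map proj₁ p
    ; distinct = subst Unique (sym (vertices-map T (a , b) p)) uniq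
    ; long     = subst (3 ≤_) (cong length (sym (vertices-map T (a , b) p)))
                   (s≤s (s≤s (vertices-nonempty (T ∖ (a , b)) q)))
    ; closing  = ~-sym a~b
    }

  root : Fin m
  root = Fin.fromℕ< (ℕ.>-nonZero⁻¹ m {{nonEmpty}})

  -- Fixing the length makes the existence of a walk decidable, so `depth` is found by search as the
  -- distance to the root.
  WalkToRoot : ℕ → Fin m → Set
  WalkToRoot zero    t = t ≡ root
  WalkToRoot (suc k) t = ∃[ s ] (t ~ s × WalkToRoot k s)

  walkToRoot? : ∀ k t → Dec (WalkToRoot k t)
  walkToRoot? zero    t = t Fin.≟ root
  walkToRoot? (suc k) t = Fin.any? λ s → (t ~? s) ×-dec walkToRoot? k s

  ∃-walkToRoot : ∀ {t r} → Star (λ a b → a ~ b × U.U a × U.U b) t r → r ≡ root → ∃[ k ] WalkToRoot k t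
  ∃-walkToRoot ε             refl = 0 , refl
  ∃-walkToRoot ((t~s , _) ◅ p) eq =
    let k , walk = ∃-walkToRoot p eq in suc k , _ , t~s , walk

  abstract
    ∃-depth : ∀ t → ∃[ k ] (WalkToRoot k t × ∀ j → WalkToRoot j t → k ≤ j)
    ∃-depth t =
      let k , walk = ∃-walkToRoot (connected t root _ _) refl
          d , _ , rest = ∃-least (λ k → walkToRoot? k t) k walk
      in d , rest

  depth : Fin m → ℕ
  depth t = proj₁ (∃-depth t)

  shortest : ∀ t → WalkToRoot (depth t) t
  shortest t = proj₁ (proj₂ (∃-depth t))

  depth-≤ : ∀ {k t} → WalkToRoot k t → depth t ≤ k
  depth-≤ {k} {t} = proj₂ (proj₂ (∃-depth t)) k

  -- The walk never visits `t`: after its first step fewer than `depth t` steps remain. So it misses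
  -- every edge at `t`.
  avoiding : ∀ {k s t p} → WalkToRoot k s → s ≢ t → k ≤ depth t →
    Star (Graph._~_ (T ∖ (t , p))) s root
  avoiding {zero}  refl _ _ = ε
  avoiding {suc k} {s} {t} (s′ , s~s′ , walk) s≢t k<d =
    (s~s′ , λ { (inj₁ (s≡t , _)) → s≢t s≡t ; (inj₂ (_ , s′≡t)) → s′≢t s′≡t }) ◅
    avoiding walk s′≢t (<⇒≤ k<d)
    where
    s′≢t : s′ ≢ t
    s′≢t refl = <⇒≱ k<d (depth-≤ walk)

  TopAt : (Fin m → Set) → Fin m → Set
  TopAt S t = ∀ {s} → S s → s ≢ t → depth t < depth s

  -- Each node is the root or has a parent, and a subtree can be left upwards
  -- only through its top.  If S contains t but not its parent p, a node s of S
  -- no deeper than t would close a walk t → s → root → p avoiding the edge tp.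
  climb : ∀ t → (∀ S → TopAt S t) ⊎ ∃[ p ] (depth p < depth t ×
    ∀ {S} → U.Decidable S → ConnectedOn T S → S t → S p ⊎ TopAt S t)
  climb t with depth t in eq | shortest t
  ... | zero | t≡root = inj₁ λ S {s} _ s≢t → n≢0⇒n>0 λ d≡0 →
    s≢t (trans (subst (λ k → WalkToRoot k s) d≡0 (shortest s)) (sym t≡root))
  ... | suc k | p , t~p , walk = inj₂ (p , s≤s (depth-≤ walk) , λ S? conn t∈S → case S? p of λ
    { (yes p∈S) → inj₁ p∈S
    ; (no p∉S) → inj₂ λ {s} s∈S s≢t → ≰⇒> λ s≤t → bridge t~p
        (Star.map (λ { (a~b , a∈S , b∈S) → a~b , λ
             { (inj₁ (_ , refl)) → p∉S b∈S
             ; (inj₂ (refl , _)) → p∉S a∈S } }) (conn t s t∈S s∈S)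
         ◅◅ avoiding (shortest s) s≢t (subst (depth s ≤_) (sym eq) s≤t)
         ◅◅ Star.reverse (λ {a} {b} → Graph.~-sym (T ∖ (t , p)) {a} {b})
              (avoiding walk (λ p≡t → ~-irrefl (sym p≡t) t~p)
                (subst (k ≤_) (sym eq) (n≤1+n k)))) })

-- Highest bags and the ranking of vertices.

module _ {n : ℕ} {G : Graph n} (D : TreeDecomposition G) {k : ℕ} (width : HasWidthAtMost D k) where
  open Graph G
  open TreeDecomposition D

  InBag : Fin n → Fin size → Set
  InBag v t = v ∈ₛ bag t

  inBag? : ∀ v t → Dec (InBag v t)
  inBag? v t = v Subset.∈? bag t

  level : Fin size → ℕ
  level = depth tree isTree

  abstract
    ∃-top : ∀ v → ∃[ t ] (InBag v t × ∀ {s} → InBag v s → level t ≤ level s)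
    ∃-top v = ∃-minimal (inBag? v) level (coversVertex v)

  top : Fin n → Fin size
  top v = proj₁ (∃-top v)

  TopAt⇒top : ∀ {v t} → InBag v t → TopAt tree isTree (InBag v) t → top v ≡ t
  TopAt⇒top {v} {t} v∈ topAt with top v Fin.≟ t
  ... | yes eq = eq
  ... | no neq = contradiction (proj₂ (proj₂ (∃-top v)) v∈) (<⇒≱ (topAt (proj₁ (proj₂ (∃-top v))) neq))

  -- Climb from the common bag while the parent contains both vertices. Stopping at the top of `u`
  -- while `v` continues would put the top of `v` strictly above that of `u`, so the climb ends at
  -- the top of `v` with `u` still present.
  common-bag⇒∈top : ∀ {u v} t → Acc _<_ (level t) → InBag u t → InBag v t →
    level (top u) ≤ level (top v) → InBag u (top v)
  common-bag⇒∈top {u} {v} t (acc rec) u∈ v∈ u≤v with climb tree isTree t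
  ... | inj₁ topAt = subst (InBag u) (sym (TopAt⇒top v∈ (topAt (InBag v)))) u∈
  ... | inj₂ (p , p<t , leave) with leave (inBag? v) (coherent v) v∈ | leave (inBag? u) (coherent u) u∈
  ...   | inj₂ topAt | _ = subst (InBag u) (sym (TopAt⇒top v∈ topAt)) u∈
  ...   | inj₁ v∈p | inj₁ u∈p = common-bag⇒∈top p (rec p<t) u∈p v∈p u≤v
  ...   | inj₁ v∈p | inj₂ topAt = contradiction p<t (≤⇒≯ (begin
    level t       ≡⟨ cong level (TopAt⇒top u∈ topAt) ⟨
    level (top u) ≤⟨ u≤v ⟩
    level (top v) ≤⟨ proj₂ (proj₂ (∃-top v)) v∈p ⟩
    level p       ∎))
    where open ≤-Reasoning

  -- The index breaks ties between vertices with equally deep tops.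
  treeRank : Fin n → ℕ
  treeRank v = n * level (top v) + toℕ v

  -- Each level owns a block of `n` consecutive ranks, as `toℕ v` is below `n`.
  treeRank⇒level : ∀ {u v} → treeRank u ≤ treeRank v → level (top u) ≤ level (top v)
  treeRank⇒level {u} {v} le = ≮⇒≥ λ lt → <⇒≱ (begin-strict
    n * level (top v) + toℕ v <⟨ +-monoʳ-< (n * level (top v)) (Fin.toℕ<n v) ⟩
    n * level (top v) + n     ≡⟨ +-comm _ n ⟩
    n + n * level (top v)     ≡⟨ *-suc n _ ⟨
    n * suc (level (top v))   ≤⟨ *-monoʳ-≤ n lt ⟩
    n * level (top u)         ≤⟨ m≤m+n _ _ ⟩
    n * level (top u) + toℕ u ∎) le
    where open ≤-Reasoning

  -- `lower v` is the highest bag of `v` without `v`, hence of size at most `k`. Its last two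
  -- properties come from `common-bag⇒∈top`, with a bag covering the edge and with `top w` as the
  -- common bag.
  elimination : Elimination k G
  elimination = record
    { rank           = treeRank
    ; rank-injective = λ {u} {v} eq → Fin.toℕ-injective (+-cancelˡ-≡ (n * level (top u)) _ _
        (trans eq (cong (λ d → n * d + toℕ v)
          (≤-antisym (treeRank⇒level {v} {u} (≤-reflexive (sym eq))) (treeRank⇒level {u} {v} (≤-reflexive eq))))))
    ; lower          = lower
    ; lower-length   = λ v → ≤-pred (≤-trans
        (length≤∣∣ (All.tabulate (λ x∈ → proj₂ (∈-lower⁻ x∈) ∘ sym) ∷ Unique.filter⁺ (lower? v) (Unique.allFin⁺ n))
          (proj₁ (proj₂ (∃-top v)) ∷ All.tabulate (proj₁ ∘ ∈-lower⁻)))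
        (width (top v)))
    ; lower-adjacent = λ u~v u<v → let t , u∈ , v∈ = coversEdge u~v in
        ∈-lower⁺ (common-bag⇒∈top t (<-wellFounded _) u∈ v∈ (treeRank⇒level (<⇒≤ u<v))) u<v
    ; lower-shared   = λ {u} {v} {w} u∈ v∈ u<v →
        ∈-lower⁺ (common-bag⇒∈top (top w) (<-wellFounded _)
          (proj₁ (∈-lower⁻ u∈)) (proj₁ (∈-lower⁻ v∈)) (treeRank⇒level (<⇒≤ u<v))) u<v
    }
    where
    lower? : ∀ v u → Dec (InBag u (top v) × u ≢ v)
    lower? v u = inBag? u (top v) ×-dec ¬? (u Fin.≟ v)
    lower : Fin n → List (Fin n)
    lower v = filter (lower? v) (allFin n)
    ∈-lower⁻ : ∀ {u v} → u ∈ lower v → InBag u (top v) × u ≢ v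
    ∈-lower⁻ {u} {v} u∈ = proj₂ (∈-filter⁻ (lower? v) {xs = allFin n} u∈)
    ∈-lower⁺ : ∀ {u v} → InBag u (top v) → treeRank u < treeRank v → u ∈ lower v
    ∈-lower⁺ {u} {v} u∈ u<v = ∈-filter⁺ (lower? v) (∈-allFin u) (u∈ , λ { refl → <-irrefl refl u<v })

-- The list chromatic index

module _ {m n : ℕ} {P : (Fin m → Fin n) → Set}
  (resp : ∀ {f g} → f ≗ g → P f → P g) (P? : ∀ f → Dec (P f)) where

  -- Functions are coded as numbers; decoding returns a function only up to pointwise equality,
  -- hence `resp`.
  ∀-function? : Dec (∀ f → P f)
  ∀-function? = map′ (λ all f → resp (Fin.finToFun-funToFin f) (all (funToFin f)))
    (λ all i → all (finToFun i)) (Fin.all? (λ i → P? (finToFun i)))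

  ∃-function? : Dec (∃ P)
  ∃-function? = map′ (λ (i , p) → finToFun i , p)
    (λ (f , p) → funToFin f , resp (λ i → sym (Fin.finToFun-funToFin f i)) p)
    (Fin.any? (λ i → P? (finToFun i)))

module _ {m : ℕ} (g : Fin m → ℕ) where

  search : ℕ → Fin m → Fin m
  search y default with Fin.any? (λ i → g i ℕ.≟ y)
  ... | yes (i , _) = i
  ... | no _        = default

  search-cong : ∀ {i j y} → g i ≡ y → search y i ≡ search y j
  search-cong {i} {j} {y} eq with Fin.any? (λ i → g i ℕ.≟ y)
  ... | yes _   = refl
  ... | no none = contradiction (i , eq) none

  search-correct : ∀ {i y} → g i ≡ y → g (search y i) ≡ y
  search-correct {i} {y} eq with Fin.any? (λ i → g i ℕ.≟ y)
  ... | yes (_ , eq′) = eq′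
  ... | no _          = eq

  -- Each value of `g` is replaced by one position carrying it, so the coincidences of arbitrary
  -- colours reappear inside `Fin m`.
  representative : Fin m → Fin m
  representative i = search (g i) i

  representative-cong : ∀ {i j} → g i ≡ g j → representative i ≡ representative j
  representative-cong {i} {j} eq = trans (search-cong {j = j} refl) (cong (λ y → search y j) eq)

  representative-injective : ∀ {i j} → representative i ≡ representative j → g i ≡ g j
  representative-injective eq =
    trans (sym (search-correct refl)) (trans (cong g eq) (search-correct refl))

-- Enumeration of edges and decidability of choosability.

module _ {n : ℕ} (G : Graph n) where
  open Graph G
  open Edge

  edge-≡ : ∀ {e f : Edge G} → lo e ≡ lo f → hi e ≡ hi f → e ≡ f
  edge-≡ refl refl = refl

  edge-< : ∀ (e : Edge G) → lo e Fin.< hi e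
  edge-< (edge u v u<v _) = recompute (u Fin.<? v) u<v

  edge-~ : ∀ (e : Edge G) → lo e ~ hi e
  edge-~ (edge u v _ u~v) = recompute (u ~? v) u~v

  edgesAt : Fin n × Fin n → List (Edge G)
  edgesAt (u , v) with u Fin.<? v | u ~? v
  ... | yes u<v | yes u~v = edge u v u<v u~v ∷ []
  ... | _       | _       = []

  edgesAt-edge : ∀ e → edgesAt (lo e , hi e) ≡ e ∷ []
  edgesAt-edge e with lo e Fin.<? hi e | lo e ~? hi e
  ... | yes _ | yes _ = refl
  ... | yes _ | no ¬p = contradiction (edge-~ e) ¬p
  ... | no ¬p | _     = contradiction (edge-< e) ¬p

  edges : List (Edge G)
  edges = concatMap edgesAt (cartesianProduct (allFin n) (allFin n))

  ∈-edges : ∀ e → e ∈ edges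
  ∈-edges e = ∈-concatMap⁺ edgesAt
    (lose (∈-cartesianProduct⁺ (∈-allFin (lo e)) (∈-allFin (hi e))) (subst (e ∈_) (sym (edgesAt-edge e)) (here refl)))

  index : Edge G → Fin (length edges)
  index e = Any.index (∈-edges e)

  lookup-edges : ∀ e → lookup edges (index e) ≡ e
  lookup-edges e = sym (lookup-index (∈-edges e))

  ∀-edge? : {P : Edge G → Set} → U.Decidable P → Dec (∀ e → P e)
  ∀-edge? P? = map′ (λ all e → All.lookup all (∈-edges e)) (λ all → All.tabulate λ {e} _ → all e)
    (All.all? P? edges)

  _≟ₑ_ : ∀ (e f : Edge G) → Dec (e ≡ f)
  e ≟ₑ f = map′ (λ (p , q) → edge-≡ p q) (λ { refl → refl , refl })
    ((lo e Fin.≟ lo f) ×-dec (hi e Fin.≟ hi f))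

  isEndOf? : ∀ v e → Dec (_isEndOf_ G v e)
  isEndOf? v e = (v Fin.≟ lo e) ⊎-dec (v Fin.≟ hi e)

  adjacentEdges? : ∀ e f → Dec (AdjacentEdges G e f)
  adjacentEdges? e f = ¬? (e ≟ₑ f) ×-dec Fin.any? (λ v → isEndOf? v e ×-dec isEndOf? v f)

  -- Only the coincidences between the list entries matter, so it suffices to
  -- consider lists of size k whose entries are positions in the family of lists.
  module _ (k : ℕ) where
    M = length edges * k

    entry : ∀ {A : Set} → (Fin M → A) → Edge G → Fin k → A
    entry F e i = F (combine (index e) i)

    ProperChoice : (Fin M → Fin M) → (Fin (length edges) → Fin k) → Set
    ProperChoice F c = ∀ e f → AdjacentEdges G e f →
      entry F e (c (index e)) ≢ entry F f (c (index f))

    FinitelyChoosable : Set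
    FinitelyChoosable = ∀ (F : Fin M → Fin M) →
      (∀ e i j → entry F e i ≡ entry F e j → i ≡ j) → ∃ (ProperChoice F)

    finitelyChoosable? : Dec FinitelyChoosable
    finitelyChoosable? = ∀-function?
      (λ f≗g choosable inj →
        let c , proper = choosable λ e i j eq → inj e i j
              (trans (sym (f≗g _)) (trans eq (f≗g _)))
        in c , λ e f adj eq → proper e f adj (trans (f≗g _) (trans eq (sym (f≗g _)))))
      λ F → (∀-edge? λ e → Fin.all? λ i → Fin.all? λ j →
              (entry F e i Fin.≟ entry F e j) →-dec (i Fin.≟ j)) →-dec
        ∃-function? {P = ProperChoice F}
          (λ c≗d proper e f adj eq → proper e f adj
            (trans (cong (entry F e) (c≗d _)) (trans eq (cong (entry F f) (sym (c≗d _))))))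
          λ c → ∀-edge? λ e → ∀-edge? λ f → adjacentEdges? e f →-dec ¬? (_ Fin.≟ _)

    -- Representatives preserve and reflect equality of colours, so the lists stay repetition-free
    -- and a proper choice transfers back.
    finitelyChoosable⇒ : FinitelyChoosable → EdgeChoosable G k
    finitelyChoosable⇒ choosable L large = record
      { colour   = λ e → colours (position e)
      ; fromList = λ e → subst (λ e′ → L e′ (colours (position e))) (lookup-edges e)
          (subst (L _) (sym (colours-entry (index e) (c (index e)))) (proj₂ (proj₂ (large _)) _))
      ; proper   = λ e f adj eq → proj₂ chosen e f adj (representative-cong colours eq)
      }
      where
      colours : Fin M → ℕ
      colours p = let i , j = remQuot k p in proj₁ (large (lookup edges i)) j
      colours-entry : ∀ i j → colours (combine i j) ≡ proj₁ (large (lookup edges i)) j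
      colours-entry i j = cong (λ (i , j) → proj₁ (large (lookup edges i)) j) (Fin.remQuot-combine i j)
      chosen : ∃ (ProperChoice (representative colours))
      chosen = choosable (representative colours) λ e i j eq →
        proj₁ (proj₂ (large (lookup edges (index e))))
          (trans (sym (colours-entry (index e) i))
            (trans (representative-injective colours eq) (colours-entry (index e) j)))
      c = proj₁ chosen
      position : Edge G → Fin M
      position e = combine (index e) (c (index e))

    -- Positions are read as natural numbers; the membership proof of each colour names the chosen
    -- entry.
    ⇒finitelyChoosable : EdgeChoosable G k → FinitelyChoosable
    ⇒finitelyChoosable choosable F inj = c , λ e f adj eq → proper e f adj
      (trans (sym (c-colour e)) (trans (cong toℕ eq) (c-colour f)))
      where
      colouring : ListEdgeColouring G (λ e y → ∃[ i ] toℕ (entry F e i) ≡ y)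
      colouring = choosable _ λ e → toℕ ∘ entry F e , inj e _ _ ∘ Fin.toℕ-injective , λ i → i , refl
      open ListEdgeColouring colouring
      c : Fin (length edges) → Fin k
      c i = proj₁ (fromList (lookup edges i))
      c-colour : ∀ e → toℕ (entry F e (c (index e))) ≡ colour e
      c-colour e = trans (cong (λ e′ → toℕ (entry F e (proj₁ (fromList e′)))) (lookup-edges e))
        (proj₂ (fromList e))

    edgeChoosable? : Dec (EdgeChoosable G k)
    edgeChoosable? = map′ finitelyChoosable⇒ ⇒finitelyChoosable finitelyChoosable?

  deg≤Δ : ∀ v → deg G v ≤ Δ G
  deg≤Δ v = ≤-trans
    (length≤∣∣ {p = neighbours G v} (nbrs-unique G v) (All.tabulate λ {w} w∈ → lookup⇒[]= w _
      (trans (lookup∘tabulate (λ w → does (v ~? w)) w) (dec-true (v ~? w) (∈-nbrs⁻ G w∈)))))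
    (All.lookup (xs≤max 0 (tabulate (degree G))) (∈-tabulate⁺ v))

  -- From lists on edges to lists on pairs of vertices.

  module _ {k : ℕ} (L : ListAssignment G) (large : ∀ e → HasAtLeast G k (L e)) where

    edgeList : Edge G → List ℕ
    edgeList e = tabulate (proj₁ (large e))

    edgeList-unique : ∀ e → Unique (edgeList e)
    edgeList-unique e = Unique.tabulate⁺ (proj₁ (proj₂ (large e)))

    firstList : List (Edge G) → List ℕ
    firstList []      = []
    firstList (e ∷ _) = edgeList e

    ordered : Fin n → Fin n → Fin n × Fin n
    ordered u v with u Fin.<? v
    ... | yes _ = u , v
    ... | no _  = v , u

    ordered-sym : ∀ u v → ordered u v ≡ ordered v u
    ordered-sym u v with u Fin.<? v | v Fin.<? u
    ... | yes u<v | yes v<u = contradiction v<u (Fin.<-asym u<v)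
    ... | yes _   | no _    = refl
    ... | no _    | yes _   = refl
    ... | no u≮v  | no v≮u  = cong₂ _,_ (sym u≡v) u≡v
      where u≡v = Fin.≤-antisym (≮⇒≥ v≮u) (≮⇒≥ u≮v)

    -- Ordering the pair first gives symmetry; pairs that are not edges get the empty list.
    pairLists : Lists {n}
    pairLists = record
      { lists  = λ u v → firstList (edgesAt (ordered u v))
      ; symm   = λ u v → cong (firstList ∘ edgesAt) (ordered-sym u v)
      ; unique = λ u v → firstList-unique (edgesAt (ordered u v))
      }
      where
      firstList-unique : ∀ es → Unique (firstList es)
      firstList-unique []      = []
      firstList-unique (e ∷ _) = edgeList-unique e

    open Lists pairLists

    lists-edge : ∀ e → lists (lo e) (hi e) ≡ edgeList e
    lists-edge e with lo e Fin.<? hi e in eq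
    ... | yes _ = cong firstList (edgesAt-edge e)
    ... | no ¬p = contradiction (edge-< e) ¬p

    edge-length : ∀ e → k ≤ length (lists (lo e) (hi e))
    edge-length e = ≤-reflexive (sym (trans (cong length (lists-edge e)) (length-tabulate _)))

    lists-length : ∀ {u v} → u ~ v → k ≤ length (lists u v)
    lists-length {u} {v} u~v with Fin.<-cmp u v
    ... | tri< u<v _ _ = edge-length (edge u v u<v u~v)
    ... | tri≈ _ u≡v _ = contradiction u~v (~-irrefl u≡v)
    ... | tri> _ _ v<u = subst (λ xs → k ≤ length xs) (symm v u) (edge-length (edge v u v<u (~-sym u~v)))

    fromPairs : Colouring pairLists G → ListEdgeColouring G L
    fromPairs κ = record
      { colour   = λ e → colour (lo e) (hi e)
      ; fromList = λ e →
          let i , eq = ∈-tabulate⁻ (subst (_ ∈_) (lists-edge e) (listed (edge-~ e)))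
          in subst (L e) (sym eq) (proj₂ (proj₂ (large e)) i)
      ; proper   = λ e f (e≢f , v , v∈e , v∈f) → go e f e≢f v∈e v∈f
      }
      where
      open Colouring κ
      go : ∀ e f {v} → e ≢ f → _isEndOf_ G v e → _isEndOf_ G v f →
        colour (lo e) (hi e) ≢ colour (lo f) (hi f)
      go e@(edge a b _ _) f@(edge _ d _ _) e≢f (inj₁ refl) (inj₁ refl) =
        proper (edge-~ e) (edge-~ f) λ { refl → e≢f refl }
      go e@(edge a b _ _) f@(edge c _ _ _) e≢f (inj₂ refl) (inj₂ refl) =
        subst₂ _≢_ (colour-sym b a) (colour-sym b c)
          (proper (~-sym (edge-~ e)) (~-sym (edge-~ f)) λ { refl → e≢f refl })
      -- The shared vertex is the lower end of `e` and the upper end of `f`; equal other ends would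
      -- reverse the order.
      go e@(edge a b _ _) f@(edge c _ _ _) e≢f (inj₁ refl) (inj₂ refl) =
        subst (colour a b ≢_) (colour-sym a c)
          (proper (edge-~ e) (~-sym (edge-~ f)) λ { refl → Fin.<-asym (edge-< e) (edge-< f) })
      go e@(edge a b _ _) f@(edge _ d _ _) e≢f (inj₂ refl) (inj₁ refl) =
        subst (_≢ colour b d) (colour-sym b a)
          (proper (~-sym (edge-~ e)) (edge-~ f) λ { refl → Fin.<-asym (edge-< e) (edge-< f) })

theorem1 : ∀ {n : ℕ} (G : Graph n) → IsTreeWidth G 3 →
    ∃[ k ] (IsListChromaticIndex G k × k ≤ Δ G + 1)
theorem1 G ((D , width) , _) =
  -- Choosability at Δ(G) + 1 bounds the search for the least choosable number.
  let k , k≤ , choosable , least = ∃-least (edgeChoosable? G) (Δ G + 1)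
        (subst (EdgeChoosable G) (+-comm 1 (Δ G)) λ L large →
          fromPairs G L large
            (colourable (pairLists G L large) (Δ G) G (elimination D width)
              (lists-length G L large) (deg≤Δ G)))
  in k , (choosable , least) , k≤
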